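{- Every ($2K_2$, claw)-free graph $G$ on $n$ vertices is recolorable, and the diameter of $R_\ell(G)$ is at most $2n^2$ for all $\ell\ge\chi(G)+1$.
   Context: All graphs are finite and simple. A $k$-coloring of $G$ is a map $V(G)\to\{1,\dots,k\}$ giving adjacent vertices different values; $\chi(G)$ is the chromatic number. $R_k(G)$ denotes the graph whose vertices are the $k$-colorings of $G$, two being adjacent if they differ in color on exactly one vertex. $G$ is recolorable if $R_\ell(G)$ is connected for all $\ell\ge\chi(G)+1$. A graph is $(H_1,H_2)$-free if it has no induced subgraph isomorphic to $H_1$ or $H_2$. $2K_2$ is the disjoint union of two edges; the claw is $K_{1,3}$. -}

module Defs where

open import Data.Bool using (Bool; true; false)
import Data.Bool.Properties as Bool
open import Data.Fin using (Fin; splitAt)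
import Data.Fin.Properties as Fin
open import Data.Nat using (ℕ; zero; suc; _+_; _≤_; _≥_)
open import Data.Product using (∃-syntax; ∃!; _×_)
open import Data.Sum using (inj₁; inj₂; [_,_])
open import Data.Sum.Relation.Binary.Pointwise using (Pointwise; inj₁; inj₂; ⊎-symmetric; ⊎-decidable)
open import Function using (const; _∘_; _⇔_)
open import Function.Definitions using (Injective)
open import Level using (0ℓ)
open import Relation.Binary using (Rel; Decidable; Symmetric)
open import Relation.Binary.PropositionalEquality using (_≡_; _≢_; refl; ≢-sym)
open import Relation.Nullary using (¬_)
open import Relation.Nullary.Decidable using (¬?)

IsLeast : (ℕ → Set) → ℕ → Set
IsLeast P m = P m × (∀ k → P k → m ≤ k)

IsGreatest : (ℕ → Set) → ℕ → Set
IsGreatest P m = P m × (∀ k → P k → k ≤ m)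

-- Finite simple graphs.  Adjacency is decidable, as it is for every finite
-- graph in classical mathematics.

record Graph (n : ℕ) : Set₁ where
  field
    Adj    : Rel (Fin n) 0ℓ
    adj?   : Decidable Adj
    sym    : Symmetric Adj
    irrefl : ∀ {v} → ¬ Adj v v

open Graph using (Adj)

complete : ∀ n → Graph n
complete n = record
  { Adj    = _≢_
  ; adj?   = λ u v → ¬? (u Fin.≟ v)
  ; sym    = ≢-sym
  ; irrefl = λ v≢v → v≢v refl
  }

infixr 5 _⊎ᴳ_

_⊎ᴳ_ : ∀ {m n} → Graph m → Graph n → Graph (m + n)
_⊎ᴳ_ {m} G H = record
  { Adj    = λ u v → Pointwise (Adj G) (Adj H) (splitAt m u) (splitAt m v)
  ; adj?   = λ u v → ⊎-decidable (Graph.adj? G) (Graph.adj? H) (splitAt m u) (splitAt m v)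
  ; sym    = ⊎-symmetric (Graph.sym G) (Graph.sym H)
  ; irrefl = λ {v} → irreflexive (splitAt m v)
  }
  where
  irreflexive : ∀ x → ¬ Pointwise (Adj G) (Adj H) x x
  irreflexive (inj₁ _) (inj₁ e) = Graph.irrefl G e
  irreflexive (inj₂ _) (inj₂ e) = Graph.irrefl H e

completeBipartite : ∀ m n → Graph (m + n)
completeBipartite m n = record
  { Adj    = λ u v → side u ≢ side v
  ; adj?   = λ u v → ¬? (side u Bool.≟ side v)
  ; sym    = ≢-sym
  ; irrefl = λ s≢s → s≢s refl
  }
  where
  side : Fin (m + n) → Bool
  side = [ const true , const false ] ∘ splitAt m

2K₂ : Graph 4
2K₂ = complete 2 ⊎ᴳ complete 2

claw : Graph 4
claw = completeBipartite 1 3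

-- An isomorphism from H onto the subgraph of G induced by the image of `embed`.

record InducedCopy {m n} (H : Graph m) (G : Graph n) : Set where
  field
    embed     : Fin m → Fin n
    injective : Injective _≡_ _≡_ embed
    adj⇔      : ∀ u v → Adj H u v ⇔ Adj G (embed u) (embed v)

_,_-Free : ∀ {m₁ m₂ n} → Graph m₁ → Graph m₂ → Graph n → Set
(H₁ , H₂ -Free) G = ¬ InducedCopy H₁ G × ¬ InducedCopy H₂ G

record Coloring {n} (G : Graph n) (k : ℕ) : Set where
  field
    color  : Fin n → Fin k
    proper : ∀ {u v} → Adj G u v → color u ≢ color v

open Coloring using (color)

IsChromaticNumber : ∀ {n} → Graph n → ℕ → Set
IsChromaticNumber G = IsLeast (Coloring G)

-- Vertex equality is a parameter of the notions below because, without function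
-- extensionality, colorings have to be identified when they agree pointwise.

module _ {V : Set} (_≈_ _~_ : Rel V 0ℓ) where

  data Walk : ℕ → Rel V 0ℓ where
    stop : ∀ {x y} → x ≈ y → Walk zero x y
    step : ∀ {l x y z} → x ~ y → Walk l y z → Walk (suc l) x z

  Connected : Set
  Connected = ∀ x y → ∃[ l ] Walk l x y

  IsDistance : V → V → ℕ → Set
  IsDistance x y = IsLeast (λ l → Walk l x y)

  -- Connectedness is included because a disconnected graph has infinite diameter.

  IsDiameter : ℕ → Set
  IsDiameter D = Connected × IsGreatest (λ d → ∃[ x ] ∃[ y ] IsDistance x y d) D

module Reconfiguration {n} (G : Graph n) (k : ℕ) where

  _≈_ : Rel (Coloring G k) 0ℓ
  c ≈ d = ∀ v → color c v ≡ color d v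

  _~_ : Rel (Coloring G k) 0ℓ
  c ~ d = ∃! _≡_ (λ v → color c v ≢ color d v)

  R-Connected : Set
  R-Connected = Connected _≈_ _~_

  R-IsDiameter : ℕ → Set
  R-IsDiameter = IsDiameter _≈_ _~_

open Reconfiguration public using (R-Connected; R-IsDiameter)

Recolorable : ∀ {n} → Graph n → Set
Recolorable G = ∀ χ → IsChromaticNumber G χ → ∀ ℓ → ℓ ≥ χ + 1 → R-Connected G ℓ

{-# OPTIONS --safe #-}

-- Let χ(G) < ℓ.  We connect any two ℓ-colorings so that every vertex is recolored
-- at most 2n times.
--
-- If u and v are nonadjacent and N(u) ⊆ N(v), then G retracts onto G − u by folding
-- u onto v.  Recoloring u like v, following a sequence for G − u in which u copies v,
-- and finally recoloring u settles this case by induction, at a cost of two further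
-- recolorings per vertex.
--
-- Without such a pair, a (2K₂, claw)-free graph has no independent triple: for an
-- independent triple a, b, c, 2K₂-freeness yields a common neighbor w of b and c, and
-- then a common neighbor z of a and b with z ≁ w.  By claw-freeness a ≁ w and c ≁ z,
-- so az and cw induce a 2K₂.
--
-- Without independent triples, let γ be a coloring with fewer than ℓ colors.  Its
-- classes have size at most 2, so n < 2ℓ and the given ℓ-coloring uses some color e at
-- most once.  The γ-class of the vertex colored e (any γ-class if e is unused) can be
-- recolored to e as a whole and then be discarded together with e.  Iterating recolors
-- each vertex at most once and reaches a coloring with the classes of γ.
-- Two colorings with these classes differ by a renaming of colors, which one unused
-- color makes possible with at most n recolorings per vertex.
module Submission where

open import Defs
open import Data.Empty using (⊥; ⊥-elim)
open import Data.Fin as Fin using (Fin; zero; suc)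
open import Data.Fin.Patterns using (0F; 1F; 2F; 3F)
import Data.Fin.Properties as Fin
open import Data.Fin.Subset as Subset using (Subset; ⁅_⁆; _∪_)
open import Data.Fin.Subset.Induction using (⊃-wellFounded; Acc; acc)
import Data.Fin.Subset.Properties as Subset
open import Data.List using (List; []; _∷_; allFin; cartesianProduct; length; mapMaybe)
open import Data.List.Extrema.Nat using (argmax; f[xs]≤f[argmax])
open import Data.List.Membership.Propositional using (_∈_; find; lose)
open import Data.List.Membership.Propositional.Properties using (∈-allFin; ∈-cartesianProduct⁺)
open import Data.List.Properties using (length-tabulate)
import Data.List.Relation.Unary.All as All
open import Data.List.Relation.Unary.Any as Any using (Any; here; there)
import Data.List.Relation.Unary.Any.Properties as Any
open import Data.Maybe using (Maybe; just; nothing)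
import Data.Maybe.Relation.Unary.Any as Maybe
open import Data.Nat using (ℕ; zero; suc; _+_; _*_; _∸_; _^_; _≤_; _<_; _≥_; z≤n; s≤s)
open import Data.Nat.Induction using (<-rec)
import Data.Nat.Properties as ℕ
open import Algebra.Properties.Monoid.Sum ℕ.+-0-monoid using (sum)
open import Data.Product using (∃-syntax; _×_; _,_; proj₁; proj₂)
open import Data.Sum using (_⊎_; inj₁; inj₂)
import Data.Sum.Relation.Binary.Pointwise as Pointwise
open import Data.Vec as Vec using ([]; _∷_)
open import Data.Vec.Functional using (updateAt)
open import Data.Vec.Functional.Properties using (updateAt-updates; updateAt-minimal)
open import Function using (_∘_; const; id)
open import Function.Bundles using (_⇔_; mk⇔; Equivalence)
open import Relation.Binary using (Rel; Decidable; tri<; tri≈; tri>)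
open import Relation.Binary.PropositionalEquality
  using (_≡_; _≢_; _≗_; refl; sym; trans; cong; cong₂; subst; subst₂)
open import Relation.Nullary using (¬_; Dec; yes; no; contradiction)
open import Relation.Nullary.Decidable using (¬?; _×-dec_; _→-dec_; _⊎-dec_; map′)

open Graph using (Adj; adj?)
open Coloring using (color; proper)
open Equivalence using (to; from)

-- Sums of recoloring budgets

sum-mono-≤ : ∀ {n} {b c : Fin n → ℕ} → (∀ v → b v ≤ c v) → sum b ≤ sum c
sum-mono-≤ {zero}  b≤c = z≤n
sum-mono-≤ {suc n} b≤c = ℕ.+-mono-≤ (b≤c zero) (sum-mono-≤ (b≤c ∘ suc))

sum-mono-< : ∀ {n} {b c : Fin n → ℕ} → (∀ v → b v ≤ c v) → ∀ v → b v < c v → sum b < sum c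
sum-mono-< b≤c zero    b<c = ℕ.+-mono-<-≤ b<c (sum-mono-≤ (b≤c ∘ suc))
sum-mono-< b≤c (suc v) b<c = ℕ.+-mono-≤-< (b≤c zero) (sum-mono-< (b≤c ∘ suc) v b<c)

sum-const : ∀ n m → sum {n} (const m) ≡ n * m
sum-const zero    m = refl
sum-const (suc n) m = cong (m +_) (sum-const n m)

-- Recoloring sequences

module RecoloringWalk {n} (G : Graph n) (k : ℕ) where

  open Reconfiguration G k using (_≈_; _~_)

  RWalk : ℕ → Rel (Coloring G k) _
  RWalk = Walk _≈_ _~_

  ~-resp : ∀ {α α′ β β′} → α ≈ α′ → β ≈ β′ → α ~ β → α′ ~ β′
  ~-resp α≈α′ β≈β′ (v , differ , unique) =
    v , subst₂ _≢_ (α≈α′ v) (β≈β′ v) differ ,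
    λ {w} ≢w → unique (subst₂ _≢_ (sym (α≈α′ w)) (sym (β≈β′ w)) ≢w)

  walk-resp : ∀ {l α α′ β β′} → α ≈ α′ → β ≈ β′ → RWalk l α β → RWalk l α′ β′
  walk-resp α≈α′ β≈β′ (stop α≈β) = stop λ v → trans (sym (α≈α′ v)) (trans (α≈β v) (β≈β′ v))
  walk-resp {α = α} {α′} α≈α′ β≈β′ (step {y = γ} α~γ w) =
    step (~-resp {α} {α′} {γ} {γ} α≈α′ (λ _ → refl) α~γ) (walk-resp {α = γ} {γ} (λ _ → refl) β≈β′ w)

-- Each vertex v is recolored at most b v times on the way from α to γ.

infix 4 _⟶[_]_

data _⟶[_]_ {n} {G : Graph n} {k} (α : Coloring G k) (b : Fin n → ℕ) (γ : Coloring G k) : Set where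
  done : color α ≗ color γ → α ⟶[ b ] γ
  move : ∀ {β b′} v → (∀ w → w ≢ v → color α w ≡ color β w) → β ⟶[ b′ ] γ →
         (∀ w → b′ w ≤ b w) → b′ v < b v → α ⟶[ b ] γ

module _ {n : ℕ} {G : Graph n} {k : ℕ} where

  open RecoloringWalk G k using (RWalk; walk-resp)

  private
    variable
      α β γ : Coloring G k
      b c   : Fin n → ℕ

  weaken : (∀ v → b v ≤ c v) → α ⟶[ b ] β → α ⟶[ c ] β
  weaken b≤c (done α≈β)              = done α≈β
  weaken b≤c (move v α≈α′ p b′≤b b′<b) =
    move v α≈α′ p (λ w → ℕ.≤-trans (b′≤b w) (b≤c w)) (ℕ.<-≤-trans b′<b (b≤c v))

  respˡ : color α ≗ color β → β ⟶[ b ] γ → α ⟶[ b ] γ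
  respˡ α≈β (done β≈γ)            = done (λ v → trans (α≈β v) (β≈γ v))
  respˡ α≈β (move v β≈ p b′≤b b′<b) = move v (λ w w≢v → trans (α≈β w) (β≈ w w≢v)) p b′≤b b′<b

  ⟶-trans : α ⟶[ b ] β → β ⟶[ c ] γ → α ⟶[ (λ v → b v + c v) ] γ
  ⟶-trans {b = b} (done α≈β) q = weaken (λ v → ℕ.m≤n+m _ (b v)) (respˡ α≈β q)
  ⟶-trans {c = c} (move v α≈α′ p b′≤b b′<b) q =
    move v α≈α′ (⟶-trans p q) (λ w → ℕ.+-monoˡ-≤ (c w) (b′≤b w)) (ℕ.+-monoˡ-< (c v) b′<b)

  -- `reverse` with an accumulator: each move of the first sequence is undone and put in front of
  -- the second, charged to what it took from the budget, so the two budgets add up.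
  reverse-onto : α ⟶[ b ] β → α ⟶[ c ] γ → β ⟶[ (λ v → b v + c v) ] γ
  reverse-onto {b = b} (done α≈β) q = weaken (λ v → ℕ.m≤n+m _ (b v)) (respˡ (sym ∘ α≈β) q)
  reverse-onto {b = b} {c = c} (move {b′ = b′} v α≈α′ p b′≤b b′<b) q =
    weaken (λ w → ℕ.≤-reflexive (total w))
      (reverse-onto p (move {b = λ w → (b w ∸ b′ w) + c w} v (λ w w≢v → sym (α≈α′ w w≢v)) q
        (λ w → ℕ.m≤n+m (c w) _) (ℕ.+-monoˡ-≤ (c v) (ℕ.m<n⇒0<n∸m b′<b))))
    where
    total : ∀ w → b′ w + ((b w ∸ b′ w) + c w) ≡ b w + c w
    total w = trans (sym (ℕ.+-assoc (b′ w) _ (c w))) (cong (_+ c w) (ℕ.m+[n∸m]≡n (b′≤b w)))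

  reverse : α ⟶[ b ] β → β ⟶[ b ] α
  reverse p = weaken (λ v → ℕ.≤-reflexive (ℕ.+-identityʳ _))
    (reverse-onto p (done {b = const 0} (λ _ → refl)))

  -- A move lowers the budget strictly at `v` and raises it nowhere, so the sum of the budget drops
  -- with every step.
  toWalk : α ⟶[ b ] β → ∃[ l ] (l ≤ sum b × RWalk l α β)
  toWalk (done α≈β) = 0 , z≤n , stop α≈β
  toWalk {α = α} (move {β = α′} v α≈α′ p b′≤b b′<b) with toWalk p | color α v Fin.≟ color α′ v
  ... | l , l≤ , w | no αv≢α′v = suc l , ℕ.≤-<-trans l≤ (sum-mono-< b′≤b v b′<b) ,
    step (v , αv≢α′v , λ {w} αw≢α′w → differ w αw≢α′w) w
    where
    differ : ∀ w → color α w ≢ color α′ w → v ≡ w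
    differ w αw≢α′w with v Fin.≟ w
    ... | yes v≡w = v≡w
    ... | no  v≢w = contradiction (α≈α′ w (v≢w ∘ sym)) αw≢α′w
  -- A `move` need not change the color of `v`; such a move contributes no step to the walk.
  ... | l , l≤ , w | yes αv≡α′v =
    l , ℕ.≤-trans l≤ (sum-mono-≤ b′≤b) , walk-resp {α = α′} {α} (sym ∘ α≗α′) (λ _ → refl) w
    where
    α≗α′ : color α ≗ color α′
    α≗α′ w with w Fin.≟ v
    ... | yes refl = αv≡α′v
    ... | no  w≢v  = α≈α′ w w≢v

  -- By the condition on edges every mixture of `α` and `β` is proper, so the vertices can switch to
  -- `β` one by one in any order.
  recolor-all : ∀ (α β : Coloring G k) → (∀ {x y} → Adj G x y → color α x ≢ color β y) →
                (∀ v → color α v ≢ color β v → 1 ≤ b v) → α ⟶[ b ] β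
  recolor-all {b} α β = go (allFin n) α b (λ v _ → ∈-allFin v)
    where
    go : ∀ vs α b → (∀ v → color α v ≢ color β v → v ∈ vs) →
         (∀ {x y} → Adj G x y → color α x ≢ color β y) →
         (∀ v → color α v ≢ color β v → 1 ≤ b v) → α ⟶[ b ] β
    go [] α b covers cross paid = done same
      where
      same : color α ≗ color β
      same v with color α v Fin.≟ color β v
      ... | yes eq = eq
      ... | no neq with () ← covers v neq
    go (v ∷ vs) α b covers cross paid with color α v Fin.≟ color β v
    ... | yes αv≡βv = go vs α b covers′ cross paid
      where
      covers′ : ∀ w → color α w ≢ color β w → w ∈ vs
      covers′ w neq with covers w neq
      ... | here refl = contradiction αv≡βv neq
      ... | there w∈  = w∈
    ... | no αv≢βv =
      move v (λ w w≢v → sym (updateAt-minimal w v (color α) w≢v))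
        (go vs α′ b′ covers′ cross′ paid′) b′≤b b′<b
      where
      f = updateAt (color α) v (const (color β v))
      b′ = updateAt b v (const 0)

      f-off : ∀ w → w ≢ v → f w ≡ color α w
      f-off w = updateAt-minimal w v (color α)
      f-at : f v ≡ color β v
      f-at = updateAt-updates v (color α)

      cross′ : ∀ {x y} → Adj G x y → f x ≢ color β y
      cross′ {x} {y} x~y with x Fin.≟ v
      ... | yes refl = λ eq → proper β x~y (trans (sym f-at) eq)
      ... | no  x≢v  = λ eq → cross x~y (trans (sym (f-off x x≢v)) eq)

      proper′ : ∀ {x y} → Adj G x y → f x ≢ f y
      proper′ {x} {y} x~y eq with y Fin.≟ v | x Fin.≟ v
      ... | yes refl | _        = cross′ x~y (trans eq f-at)
      ... | no  _    | yes refl = cross′ (Graph.sym G x~y) (trans (sym eq) f-at)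
      ... | no  y≢v  | no  x≢v  = proper α x~y (trans (sym (f-off x x≢v)) (trans eq (f-off y y≢v)))

      α′ : Coloring G k
      α′ = record { color = f ; proper = proper′ }

      covers′ : ∀ w → f w ≢ color β w → w ∈ vs
      covers′ w neq with w Fin.≟ v
      ... | yes refl = contradiction f-at neq
      ... | no w≢v with covers w (neq ∘ trans (f-off w w≢v))
      ...   | here w≡v = contradiction w≡v w≢v
      ...   | there w∈ = w∈

      paid′ : ∀ w → f w ≢ color β w → 1 ≤ b′ w
      paid′ w neq with w Fin.≟ v
      ... | yes refl = contradiction f-at neq
      ... | no w≢v = subst (1 ≤_) (sym (updateAt-minimal w v b w≢v)) (paid w (neq ∘ trans (f-off w w≢v)))

      b′≤b : ∀ w → b′ w ≤ b w
      b′≤b w with w Fin.≟ v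
      ... | yes refl = subst (_≤ b v) (sym (updateAt-updates v b)) z≤n
      ... | no w≢v   = ℕ.≤-reflexive (updateAt-minimal w v b w≢v)

      b′<b : b′ v < b v
      b′<b = subst (_< b v) (sym (updateAt-updates v b)) (paid v αv≢βv)

-- Pulling colorings back along a homomorphism φ: one recoloring of φ w becomes
-- a simultaneous recoloring of the independent fibre over φ w.

pullback : ∀ {m n k} {G : Graph m} {H : Graph n} (φ : Fin m → Fin n) →
           (∀ {x y} → Adj G x y → Adj H (φ x) (φ y)) → Coloring H k → Coloring G k
pullback φ hom α = record { color = color α ∘ φ ; proper = proper α ∘ hom }

module _ {m n k : ℕ} {G : Graph m} {H : Graph n} (φ : Fin m → Fin n)
         (hom : ∀ {x y} → Adj G x y → Adj H (φ x) (φ y)) where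

  pullback-⟶ : ∀ {α β : Coloring H k} {b} → α ⟶[ b ] β →
               pullback {G = G} {H = H} φ hom α ⟶[ b ∘ φ ] pullback φ hom β
  pullback-⟶ (done α≈β) = done (α≈β ∘ φ)
  pullback-⟶ {α} {b = b} (move {β = α′} {b′} v α≈α′ p b′≤b b′<b) =
    weaken (λ w → ℕ.≤-reflexive (ℕ.m∸n+n≡m (b′≤b (φ w))))
      (⟶-trans (recolor-all {b = λ w → b (φ w) ∸ b′ (φ w)} _ _ cross paid) (pullback-⟶ p))
    where
    -- Since `H` has no loops, one of `φ x` and `φ y` is not `v`, and there `α` and `α′` agree.
    cross : ∀ {x y} → Adj G x y → color α (φ x) ≢ color α′ (φ y)
    cross {x} {y} x~y with φ y Fin.≟ v
    ... | no φy≢v = λ eq → proper α (hom x~y) (trans eq (sym (α≈α′ (φ y) φy≢v)))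
    ... | yes refl = λ eq → proper α′ (hom x~y)
      (trans (sym (α≈α′ (φ x) λ φx≡v → Graph.irrefl H (subst (λ z → Adj H z (φ y)) φx≡v (hom x~y)))) eq)
    paid : ∀ w → color α (φ w) ≢ color α′ (φ w) → 1 ≤ b (φ w) ∸ b′ (φ w)
    paid w neq with φ w Fin.≟ v
    ... | yes refl = ℕ.m<n⇒0<n∸m b′<b
    ... | no φw≢v  = contradiction (α≈α′ (φ w) φw≢v) neq

-- Graphs without independent triples

SameClasses : ∀ {n k r} → (Fin n → Fin k) → (Fin n → Fin r) → Set
SameClasses f g = ∀ x y → f x ≡ f y ⇔ g x ≡ g y

-- If every color were used, picking a vertex of each color and taking its value under `g` would
-- inject `Fin k` into `Fin r`.
unused-color : ∀ {n k r} {f : Fin n → Fin k} {g : Fin n → Fin r} → r < k → SameClasses f g →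
               ∃[ c ] (∀ x → f x ≢ c)
unused-color {f = f} {g} r<k f≋g with Fin.any? (λ c → Fin.all? λ x → ¬? (f x Fin.≟ c))
... | yes unused = unused
... | no ¬unused = ⊥-elim (Fin.<⇒notInjective r<k g∘s-injective)
  where
  used : ∀ c → ∃[ x ] f x ≡ c
  used c with Fin.any? (λ x → f x Fin.≟ c)
  ... | yes u = u
  ... | no ¬u = contradiction (c , λ x fx≡c → ¬u (x , fx≡c)) ¬unused
  g∘s-injective : ∀ {c d} → g (proj₁ (used c)) ≡ g (proj₁ (used d)) → c ≡ d
  g∘s-injective {c} {d} eq = trans (sym (proj₂ (used c)))
    (trans (from (f≋g _ _) eq) (proj₂ (used d)))

replace : ∀ {k} → Fin k → Fin k → Fin k → Fin k
replace d c a with a Fin.≟ d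
... | yes _ = c
... | no  _ = a

replace-hit : ∀ {k} {d c a : Fin k} → a ≡ d → replace d c a ≡ c
replace-hit {d = d} {a = a} a≡d with a Fin.≟ d
... | yes _  = refl
... | no a≢d = contradiction a≡d a≢d

replace-miss : ∀ {k} {d c a : Fin k} → a ≢ d → replace d c a ≡ a
replace-miss {d = d} {a = a} a≢d with a Fin.≟ d
... | yes a≡d = contradiction a≡d a≢d
... | no _    = refl

replace-injective : ∀ {k} {d c a b : Fin k} → a ≢ c → b ≢ c → replace d c a ≡ replace d c b → a ≡ b
replace-injective {d = d} {a = a} {b} a≢c b≢c eq with a Fin.≟ d | b Fin.≟ d
... | yes a≡d | yes b≡d = trans a≡d (sym b≡d)
... | yes _   | no  _   = contradiction (sym eq) b≢c
... | no  _   | yes _   = contradiction eq a≢c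
... | no  _   | no  _   = eq

module _ {n : ℕ} {G : Graph n} {k : ℕ} where

  Avoids : Coloring G k → Fin k → Set
  Avoids α c = ∀ x → color α x ≢ c

  rename : (α : Coloring G k) (d c : Fin k) → Avoids α c → Coloring G k
  rename α d c c∉α = record
    { color  = replace d c ∘ color α
    ; proper = λ x~y → proper α x~y ∘ replace-injective (c∉α _) (c∉α _) }

  rename-⟶ : ∀ {b} α d c (c∉α : Avoids α c) → (∀ x → color α x ≡ d → 1 ≤ b x) →
             α ⟶[ b ] rename α d c c∉α
  rename-⟶ {b} α d c c∉α paid = recolor-all _ _ cross paid′
    where
    cross : ∀ {x y} → Adj G x y → color α x ≢ replace d c (color α y)
    cross {x} {y} x~y with color α y Fin.≟ d
    ... | yes _ = c∉α x
    ... | no  _ = proper α x~y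
    paid′ : ∀ x → color α x ≢ replace d c (color α x) → 1 ≤ b x
    paid′ x with color α x Fin.≟ d
    ... | yes αx≡d = λ _ → paid x αx≡d
    ... | no  _    = λ ≢ → contradiction refl ≢

  rename-avoids : ∀ α d c (c∉α : Avoids α c) → Avoids (rename α d c c∉α) d
  rename-avoids α d c c∉α x with color α x Fin.≟ d
  ... | yes αx≡d = λ c≡d → c∉α x (trans αx≡d (sym c≡d))
  ... | no  αx≢d = αx≢d

  rename-classes : ∀ {r} {g : Fin n → Fin r} α d c (c∉α : Avoids α c) →
                   SameClasses (color α) g → SameClasses (color (rename α d c c∉α)) g
  rename-classes α d c c∉α α≋g x y = mk⇔
    (to (α≋g x y) ∘ replace-injective (c∉α x) (c∉α y))
    (cong (replace d c) ∘ from (α≋g x y))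

  -- One vertex v at a time: the class colored β v is moved away to an unused
  -- color, and the class of v is moved in its place.  The class moved away is
  -- not the class of v, so each vertex is recolored at most once for each v.
  permute-classes : ∀ {r} {g : Fin n → Fin r} → r < k → (α β : Coloring G k) →
                    SameClasses (color α) g → SameClasses (color β) g → α ⟶[ const n ] β
  permute-classes {g = g} r<k α β α≋g β≋g =
    subst (λ m → α ⟶[ const m ] β) (length-tabulate id) (go (allFin n) α α≋g (inj₁ ∘ ∈-allFin))
    where
    go : ∀ vs α → SameClasses (color α) g → (∀ w → w ∈ vs ⊎ color α w ≡ color β w) →
         α ⟶[ const (length vs) ] β
    go [] α α≋g settled = done same
      where
      same : color α ≗ color β
      same w with inj₂ eq ← settled w = eq
    go (v ∷ vs) α α≋g settled with color α v Fin.≟ color β v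
    ... | yes αv≡βv = weaken (λ _ → ℕ.n≤1+n _) (go vs α α≋g settled′)
      where
      settled′ : ∀ w → w ∈ vs ⊎ color α w ≡ color β w
      settled′ w with settled w
      ... | inj₁ (here refl) = inj₂ αv≡βv
      ... | inj₁ (there w∈)  = inj₁ w∈
      ... | inj₂ eq          = inj₂ eq
    ... | no αv≢βv =
      weaken cost (⟶-trans
        (⟶-trans (rename-⟶ {b = b₁} α d c c∉α paid₁) (rename-⟶ {b = b₂} μ a d d∉μ paid₂))
        (go vs α′ α′≋g settled′))
      where
      a = color α v
      d = color β v
      c = proj₁ (unused-color r<k α≋g)
      c∉α : Avoids α c
      c∉α = proj₂ (unused-color r<k α≋g)
      μ = rename α d c c∉α
      d∉μ : Avoids μ d
      d∉μ = rename-avoids α d c c∉α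
      α′ = rename μ a d d∉μ
      α′≋g : SameClasses (color α′) g
      α′≋g = rename-classes μ a d d∉μ (rename-classes α d c c∉α α≋g)

      α-β : ∀ x y → color α x ≡ color α y → color β x ≡ color β y
      α-β x y = from (β≋g x y) ∘ to (α≋g x y)
      β-α : ∀ x y → color β x ≡ color β y → color α x ≡ color α y
      β-α x y = from (α≋g x y) ∘ to (β≋g x y)

      b₁ b₂ : Fin n → ℕ
      b₁ x with color α x Fin.≟ d
      ... | yes _ = 1
      ... | no  _ = 0
      b₂ x = 1 ∸ b₁ x

      paid₁ : ∀ x → color α x ≡ d → 1 ≤ b₁ x
      paid₁ x αx≡d with color α x Fin.≟ d
      ... | yes _    = ℕ.≤-refl
      ... | no αx≢d = contradiction αx≡d αx≢d

      paid₂ : ∀ x → color μ x ≡ a → 1 ≤ b₂ x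
      paid₂ x μx≡a with color α x Fin.≟ d
      ... | yes _ = contradiction (sym μx≡a) (c∉α v)
      ... | no  _ = ℕ.≤-refl

      b₁≤1 : ∀ x → b₁ x ≤ 1
      b₁≤1 x with color α x Fin.≟ d
      ... | yes _ = ℕ.≤-refl
      ... | no  _ = z≤n

      cost : ∀ x → (b₁ x + b₂ x) + length vs ≤ suc (length vs)
      cost x = ℕ.≤-reflexive (cong (_+ length vs) (ℕ.m+[n∸m]≡n (b₁≤1 x)))

      α′-at : ∀ w → color β w ≡ d → color α′ w ≡ d
      α′-at w βw≡d = replace-hit (trans (replace-miss αw≢d) αw≡a)
        where
        αw≡a : color α w ≡ a
        αw≡a = β-α w v βw≡d
        αw≢d : color α w ≢ d
        αw≢d αw≡d = αv≢βv (trans (sym αw≡a) αw≡d)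

      settled′ : ∀ w → w ∈ vs ⊎ color α′ w ≡ color β w
      settled′ w with color β w Fin.≟ d
      ... | yes βw≡d = inj₂ (trans (α′-at w βw≡d) (sym βw≡d))
      ... | no  βw≢d with settled w
      ...   | inj₁ (here refl) = contradiction refl βw≢d
      ...   | inj₁ (there w∈)  = inj₁ w∈
      -- Neither renaming touches this `w`: its color is not `d`, and color `a` would put it into
      -- the class of `v`, forcing `color β w ≡ d`.
      ...   | inj₂ αw≡βw       = inj₂ (trans (replace-miss μw≢a) (trans μw≡αw αw≡βw))
        where
        μw≡αw : color μ w ≡ color α w
        μw≡αw = replace-miss (βw≢d ∘ trans (sym αw≡βw))
        μw≢a : color μ w ≢ a
        μw≢a μw≡a = βw≢d (α-β w v (trans (sym μw≡αw) μw≡a))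

NoIndependentTriple : ∀ {n} → Graph n → Set
NoIndependentTriple G = ∀ x y z → x ≢ y → x ≢ z → y ≢ z →
  ¬ Adj G x y → ¬ Adj G x z → ¬ Adj G y z → ⊥

-- Aligning a coloring with the classes of `γ`

module _ {n : ℕ} {G : Graph n} (α≤2 : NoIndependentTriple G)
         {r k : ℕ} (r<k : r < k) (γ : Coloring G r) where

  private
    g = color γ

    adj-≢ : ∀ {x y} → g x ≡ g y → ¬ Adj G x y
    adj-≢ gx≡gy x~y = proper γ x~y gx≡gy

    earlier? : ∀ x → Dec (∃[ y ] (y Fin.< x × g y ≡ g x))
    earlier? x = Fin.any? λ y → (y Fin.<? x) ×-dec (g y Fin.≟ g x)

    -- The classes of γ have at most two members, which rank tells apart.
    rank : Fin n → Fin 2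
    rank x with earlier? x
    ... | yes _ = suc zero
    ... | no  _ = zero

    rank-≢ : ∀ {x y} → x Fin.< y → g x ≡ g y → rank x ≢ rank y
    rank-≢ {x} {y} x<y gx≡gy with earlier? x | earlier? y
    ... | no  _ | yes _ = λ ()
    ... | _     | no ¬e = contradiction (x , x<y , gx≡gy) ¬e
    -- An earlier member `z` of the class of `x` would complete `x` and `y` to an independent
    -- triple.
    ... | yes (z , z<x , gz≡gx) | yes _ = λ _ →
      α≤2 z x y (Fin.<⇒≢ z<x) (Fin.<⇒≢ (Fin.<-trans z<x x<y)) (Fin.<⇒≢ x<y)
        (adj-≢ gz≡gx) (adj-≢ (trans gz≡gx gx≡gy)) (adj-≢ gx≡gy)

    rank-injective : ∀ {x y} → g x ≡ g y → rank x ≡ rank y → x ≡ y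
    rank-injective {x} {y} gx≡gy eq with Fin.<-cmp x y
    ... | tri≈ _ x≡y _ = x≡y
    ... | tri< x<y _ _ = contradiction eq (rank-≢ x<y gx≡gy)
    ... | tri> _ _ y<x = contradiction (sym eq) (rank-≢ y<x (sym gx≡gy))

    -- D collects the colors of γ whose classes are already classes of α.
    Finished : Subset r → Coloring G k → Set
    Finished D α = ∀ x y → g x Subset.∈ D → color α x ≡ color α y ⇔ g x ≡ g y

    -- Such a color can be given to a whole class of `γ`: only its sole carrier, if there is one,
    -- dictates which class, and that class is still unfinished.
    Sparse : Subset r → Coloring G k → Fin k → Set
    Sparse D α e = ∀ x y → color α x ≡ e → color α y ≡ e → g x Subset.∉ D × x ≡ y

    sparse? : ∀ D α e → Dec (Sparse D α e)
    sparse? D α e = Fin.all? λ x → Fin.all? λ y → (color α x Fin.≟ e) →-dec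
      ((color α y Fin.≟ e) →-dec (¬? (g x Subset.∈? D) ×-dec (x Fin.≟ y)))

    -- A positive form of the negation of `Sparse`, whose witnesses supply the two tokens of the
    -- color.
    Dense : Subset r → Coloring G k → Fin k → Set
    Dense D α e = ∃[ x ] ∃[ y ] (color α x ≡ e × color α y ≡ e × (g x Subset.∈ D ⊎ x ≢ y))

    dense : ∀ D α e → ¬ Sparse D α e → Dense D α e
    dense D α e ¬sparse with Fin.any? (λ x → Fin.any? λ y → (color α x Fin.≟ e) ×-dec
      ((color α y Fin.≟ e) ×-dec ((g x Subset.∈? D) ⊎-dec ¬? (x Fin.≟ y))))
    ... | yes d = d
    ... | no ¬d = contradiction sparse ¬sparse
      where
      sparse : Sparse D α e
      sparse x y αx≡e αy≡e = (λ gx∈D → ¬d (x , y , αx≡e , αy≡e , inj₁ gx∈D)) , x≡y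
        where
        x≡y : x ≡ y
        x≡y with x Fin.≟ y
        ... | yes eq = eq
        ... | no neq = contradiction (x , y , αx≡e , αy≡e , inj₂ neq) ¬d

    -- If no color were sparse, two tokens per color of α would inject into the
    -- at most two places per color of γ, contradicting r < k.
    token : ∀ {D α e} → Dense D α e → Fin 2 → Fin r × Fin 2
    token (x , y , _ , _ , inj₁ _) i       = g x , i
    token (x , y , _ , _ , inj₂ _) zero    = g x , rank x
    token (x , y , _ , _ , inj₂ _) (suc _) = g y , rank y

    -- What a token reveals about its color: a vertex `z` carrying it, known by its class and,
    -- unless the class is finished, by its rank as well.
    token-owner : ∀ {D α e} (t : Dense D α e) i → ∃[ z ]
      (color α z ≡ e × proj₁ (token {α = α} t i) ≡ g z × (g z Subset.∈ D ⊎ proj₂ (token {α = α} t i) ≡ rank z))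
    token-owner (x , y , αx≡e , αy≡e , inj₁ gx∈D) i       = x , αx≡e , refl , inj₁ gx∈D
    token-owner (x , y , αx≡e , αy≡e , inj₂ _)    zero    = x , αx≡e , refl , inj₂ refl
    token-owner (x , y , αx≡e , αy≡e , inj₂ _)    (suc _) = y , αy≡e , refl , inj₂ refl

    -- Equal tokens have owners in one class of `γ`. If it is known to be finished, `α` is constant
    -- on it; otherwise equal ranks make the owners equal.
    token-color : ∀ {D α e e′} → Finished D α → (t : Dense D α e) (t′ : Dense D α e′) →
                  ∀ i j → token {α = α} t i ≡ token {α = α} t′ j → e ≡ e′
    token-color {D} {α} fin t t′ i j eq with token-owner {α = α} t i | token-owner {α = α} t′ j
    ... | z , αz≡e , c , o | z′ , αz′≡e′ , c′ , o′ =
      trans (sym αz≡e) (trans (same o o′) αz′≡e′)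
      where
      gz≡gz′ : g z ≡ g z′
      gz≡gz′ = trans (sym c) (trans (cong proj₁ eq) c′)
      same : (g z Subset.∈ D ⊎ _) → (g z′ Subset.∈ D ⊎ _) → color α z ≡ color α z′
      same (inj₁ gz∈D) _ = from (fin z z′ gz∈D) gz≡gz′
      same (inj₂ _) (inj₁ gz′∈D) = sym (from (fin z′ z gz′∈D) (sym gz≡gz′))
      same (inj₂ k) (inj₂ k′) = cong (color α)
        (rank-injective gz≡gz′ (trans (sym k) (trans (cong proj₂ eq) k′)))

    token-injective : ∀ {D α e} (t : Dense D α e) i j → token {α = α} t i ≡ token {α = α} t j → i ≡ j
    token-injective (_ , _ , _ , _ , inj₁ _) i j eq = cong proj₂ eq
    token-injective (_ , _ , _ , _ , inj₂ x≢y) zero zero eq = refl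
    token-injective (_ , _ , _ , _ , inj₂ x≢y) zero (suc zero) eq =
      contradiction (rank-injective (cong proj₁ eq) (cong proj₂ eq)) x≢y
    token-injective (_ , _ , _ , _ , inj₂ x≢y) (suc zero) zero eq =
      contradiction (sym (rank-injective (cong proj₁ eq) (cong proj₂ eq))) x≢y
    token-injective (_ , _ , _ , _ , inj₂ x≢y) (suc zero) (suc zero) eq = refl

    sparse-color : ∀ D α → Finished D α → ∃[ e ] Sparse D α e
    sparse-color D α fin with Fin.any? (sparse? D α)
    ... | yes s = s
    ... | no ¬s = ⊥-elim (Fin.<⇒notInjective (ℕ.*-monoˡ-< 2 r<k) f-injective)
      where
      t : ∀ e → Dense D α e
      t e = dense D α e (λ s → ¬s (e , s))
      place : Fin k × Fin 2 → Fin r × Fin 2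
      place (e , i) = token {α = α} (t e) i
      place-injective : ∀ p q → place p ≡ place q → p ≡ q
      place-injective (e , i) (e′ , j) eq with token-color fin (t e) (t e′) i j eq
      ... | refl = cong (e ,_) (token-injective {α = α} (t e) i j eq)
      encode : ∀ {m} → Fin m × Fin 2 → Fin (m * 2)
      encode (c , i) = Fin.combine c i
      f : Fin (k * 2) → Fin (r * 2)
      f = encode ∘ place ∘ Fin.remQuot 2
      f-injective : ∀ {p q} → f p ≡ f q → p ≡ q
      f-injective {p} {q} eq = trans (sym (Fin.combine-remQuot {k} 2 p))
        (trans (cong encode (place-injective (Fin.remQuot 2 p) (Fin.remQuot 2 q) places≡)) (Fin.combine-remQuot {k} 2 q))
        where
        parts = Fin.combine-injective _ _ _ _ eq
        places≡ : place (Fin.remQuot 2 p) ≡ place (Fin.remQuot 2 q)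
        places≡ = cong₂ _,_ (proj₁ parts) (proj₂ parts)

    target : ∀ D α → Finished D α → (∃[ x ] g x Subset.∉ D) →
             ∃[ e ] ∃[ d ] (d Subset.∉ D × (∀ x → color α x ≡ e → g x ≡ d))
    target D α fin (x₀ , gx₀∉D) with sparse-color D α fin
    ... | e , sparse with Fin.any? (λ x → color α x Fin.≟ e)
    ...   | no ¬used = e , g x₀ , gx₀∉D , λ x αx≡e → contradiction (x , αx≡e) ¬used
    ...   | yes (x , αx≡e) = e , g x , proj₁ (sparse x x αx≡e αx≡e) ,
      λ y αy≡e → cong g (proj₂ (sparse y x αy≡e αx≡e))

    -- A vertex is recolored at most once, namely when its class enters `D`.
    budget : Subset r → Fin n → ℕ
    budget D x with g x Subset.∈? D
    ... | yes _ = 0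
    ... | no  _ = 1

    budget-in : ∀ {D x} → g x Subset.∈ D → budget D x ≡ 0
    budget-in {D} {x} gx∈D with g x Subset.∈? D
    ... | yes _ = refl
    ... | no ∉D = contradiction gx∈D ∉D

    budget-out : ∀ {D x} → g x Subset.∉ D → budget D x ≡ 1
    budget-out {D} {x} gx∉D with g x Subset.∈? D
    ... | yes ∈D = contradiction ∈D gx∉D
    ... | no _  = refl

    -- Induction on growing `D`: each round gives the color `e` found by `target` to the whole class
    -- `d`. Before that, `e` occurs only inside this class, so the new coloring is proper and `d`
    -- has become one of its color classes.
    align-from : ∀ D → Acc Subset._⊃_ D → ∀ α → Finished D α →
                 ∃[ β ] (SameClasses (color β) g × α ⟶[ budget D ] β)
    align-from D (acc rec) α fin with Fin.any? (λ x → ¬? (g x Subset.∈? D))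
    ... | no ¬unfinished = α , (λ x y → fin x y (all-in x)) , done (λ _ → refl)
      where
      all-in : ∀ x → g x Subset.∈ D
      all-in x with g x Subset.∈? D
      ... | yes ∈D = ∈D
      ... | no  ∉D = contradiction (x , ∉D) ¬unfinished
    ... | yes unfinished with target D α fin unfinished
    ...   | e , d , d∉D , only-d = result
      where
      f : Fin n → Fin k
      f x with g x Fin.≟ d
      ... | yes _ = e
      ... | no  _ = color α x

      f-at : ∀ {x} → g x ≡ d → f x ≡ e
      f-at {x} gx≡d with g x Fin.≟ d
      ... | yes _ = refl
      ... | no ≢d = contradiction gx≡d ≢d

      f-off : ∀ {x} → g x ≢ d → f x ≡ color α x
      f-off {x} gx≢d with g x Fin.≟ d
      ... | yes ≡d = contradiction ≡d gx≢d
      ... | no _ = refl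

      cross : ∀ {x y} → Adj G x y → color α x ≢ f y
      cross {x} {y} x~y with g y Fin.≟ d
      ... | yes gy≡d = λ αx≡e → proper γ x~y (trans (only-d x αx≡e) (sym gy≡d))
      ... | no _ = proper α x~y

      f-proper : ∀ {x y} → Adj G x y → f x ≢ f y
      f-proper {x} {y} x~y fx≡fy with g x Fin.≟ d | g y Fin.≟ d
      ... | yes gx≡d | yes gy≡d = proper γ x~y (trans gx≡d (sym gy≡d))
      ... | yes gx≡d | no  gy≢d = gy≢d (only-d y (sym fx≡fy))
      ... | no  gx≢d | yes gy≡d = gx≢d (only-d x fx≡fy)
      ... | no  _    | no  _    = proper α x~y fx≡fy

      α′ : Coloring G k
      α′ = record { color = f ; proper = f-proper }

      D′ = D ∪ ⁅ d ⁆

      d∈D′ : d Subset.∈ D′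
      d∈D′ = Subset.q⊆p∪q D ⁅ d ⁆ (Subset.x∈⁅x⁆ d)

      D⊆D′ : D Subset.⊆ D′
      D⊆D′ = Subset.p⊆p∪q ⁅ d ⁆

      D⊂D′ : D Subset.⊂ D′
      D⊂D′ = D⊆D′ , d , d∈D′ , d∉D

      split : ∀ {x} → g x Subset.∈ D′ → g x ≢ d → g x Subset.∈ D
      split gx∈D′ gx≢d with Subset.x∈p∪q⁻ D ⁅ d ⁆ gx∈D′
      ... | inj₁ gx∈D = gx∈D
      ... | inj₂ gx∈d = contradiction (Subset.x∈⁅y⁆⇒x≡y d gx∈d) gx≢d

      fin′ : Finished D′ α′
      fin′ x y gx∈D′ with g x Fin.≟ d | g y Fin.≟ d
      ... | yes gx≡d | yes gy≡d = mk⇔ (λ _ → trans gx≡d (sym gy≡d)) (λ _ → refl)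
      ... | yes gx≡d | no  gy≢d =
        mk⇔ (λ e≡αy → contradiction (only-d y (sym e≡αy)) gy≢d)
            (λ gx≡gy → contradiction (trans (sym gx≡gy) gx≡d) gy≢d)
      ... | no  gx≢d | yes gy≡d =
        mk⇔ (λ αx≡e → contradiction (only-d x αx≡e) gx≢d)
            (λ gx≡gy → contradiction (trans gx≡gy gy≡d) gx≢d)
      ... | no  gx≢d | no  _ = fin x y (split gx∈D′ gx≢d)

      -- The cost of this round: 1 on the class `d` and 0 elsewhere.
      first : Fin n → ℕ
      first x = budget D x ∸ budget D′ x

      budget-≤ : ∀ x → budget D′ x ≤ budget D x
      budget-≤ x with g x Subset.∈? D′
      ... | yes _ = z≤n
      ... | no ∉D′ = ℕ.≤-reflexive (sym (budget-out (∉D′ ∘ D⊆D′)))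

      paid : ∀ x → color α x ≢ f x → 1 ≤ first x
      paid x αx≢fx with g x Fin.≟ d
      ... | no  _    = contradiction refl αx≢fx
      ... | yes gx≡d = ℕ.≤-reflexive (sym (cong₂ _∸_
        (budget-out (d∉D ∘ subst (Subset._∈ D) gx≡d))
        (budget-in (subst (Subset._∈ D′) (sym gx≡d) d∈D′))))

      result : ∃[ β ] (SameClasses (color β) g × α ⟶[ budget D ] β)
      result with align-from D′ (rec D⊂D′) α′ fin′
      ... | β , β≋g , p = β , β≋g ,
        weaken (λ x → ℕ.≤-reflexive (ℕ.m∸n+n≡m (budget-≤ x)))
          (⟶-trans (recolor-all {b = first} α α′ cross paid) p)

  align : ∀ (α : Coloring G k) → ∃[ β ] (SameClasses (color β) g × α ⟶[ const 1 ] β)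
  align α with align-from Subset.⊥ (⊃-wellFounded Subset.⊥) α (λ _ _ ∈⊥ → contradiction ∈⊥ Subset.∉⊥)
  ... | β , β≋g , p = β , β≋g , weaken (λ x → ℕ.≤-reflexive (budget-out {x = x} Subset.∉⊥)) p

  -- One recoloring aligns `α`, `n` permute the classes, and one undoes the alignment of `β`.
  recolor-α≤2 : ∀ (α β : Coloring G k) → α ⟶[ const (1 + (n + 1)) ] β
  recolor-α≤2 α β with align α | align β
  ... | α′ , α′≋g , p | β′ , β′≋g , q =
    ⟶-trans p (⟶-trans (permute-classes r<k α′ β′ α′≋g β′≋g) (reverse q))

-- Folding a dominated vertex

module _ {n : ℕ} (G : Graph n) where

  adj⇒≢ : ∀ {x y} → Adj G x y → x ≢ y
  adj⇒≢ x~y refl = Graph.irrefl G x~y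

  separates : ∀ {x y z} → Adj G x z → ¬ Adj G y z → x ≢ y
  separates x~z y≁z refl = y≁z x~z

  -- Pairs `i < j` suffice, because adjacency is symmetric and irreflexive in both graphs.
  copy : ∀ {m} (H : Graph m) (e : Fin m → Fin n) →
         (∀ {i j} → i Fin.< j → e i ≢ e j × (Adj H i j ⇔ Adj G (e i) (e j))) → InducedCopy H G
  copy H e pair = record { embed = e ; injective = inj ; adj⇔ = agree }
    where
    inj : ∀ {i j} → e i ≡ e j → i ≡ j
    inj {i} {j} eq with Fin.<-cmp i j
    ... | tri< i<j _ _ = contradiction eq (proj₁ (pair i<j))
    ... | tri≈ _ i≡j _ = i≡j
    ... | tri> _ _ j<i = contradiction (sym eq) (proj₁ (pair j<i))
    agree : ∀ i j → Adj H i j ⇔ Adj G (e i) (e j)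
    agree i j with Fin.<-cmp i j
    ... | tri< i<j _ _ = proj₂ (pair i<j)
    ... | tri≈ _ refl _ = mk⇔ (⊥-elim ∘ Graph.irrefl H) (⊥-elim ∘ Graph.irrefl G)
    ... | tri> _ _ j<i = mk⇔ (Graph.sym G ∘ to (proj₂ (pair j<i)) ∘ Graph.sym H)
                             (Graph.sym H ∘ from (proj₂ (pair j<i)) ∘ Graph.sym G)

  adjacent : ∀ {A : Set} {x y} → A → Adj G x y → x ≢ y × (A ⇔ Adj G x y)
  adjacent p x~y = adj⇒≢ x~y , mk⇔ (const x~y) (const p)

  nonadjacent : ∀ {A : Set} {x y} → ¬ A → x ≢ y → ¬ Adj G x y → x ≢ y × (A ⇔ Adj G x y)
  nonadjacent ¬p x≢y x≁y = x≢y , mk⇔ (⊥-elim ∘ ¬p) (⊥-elim ∘ x≁y)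

  -- Forbidden subgraphs and independent triples

  module Structure (free : (2K₂ , claw -Free) G) where

    private
      symm = Graph.sym G

    -- Distinctness need not be assumed: if an end of one edge were an end of the other, it would be
    -- adjacent to a vertex that the hypotheses make nonadjacent to it.
    no-2K₂ : ∀ {a b c d} → Adj G a b → Adj G c d →
             ¬ Adj G a c → ¬ Adj G a d → ¬ Adj G b c → ¬ Adj G b d → ⊥
    no-2K₂ {a} {b} {c} {d} a~b c~d a≁c a≁d b≁c b≁d = proj₁ free (copy 2K₂ e pair)
      where
      e : Fin 4 → Fin n
      e = Vec.lookup (a ∷ b ∷ c ∷ d ∷ [])
      pair : ∀ {i j} → i Fin.< j → e i ≢ e j × (Adj 2K₂ i j ⇔ Adj G (e i) (e j))
      pair {0F} {1F} _ = adjacent (Pointwise.inj₁ λ ()) a~b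
      pair {0F} {2F} _ = nonadjacent (λ ()) (separates a~b (b≁c ∘ symm)) a≁c
      pair {0F} {3F} _ = nonadjacent (λ ()) (separates a~b (b≁d ∘ symm)) a≁d
      pair {1F} {2F} _ = nonadjacent (λ ()) (separates (symm a~b) (a≁c ∘ symm)) b≁c
      pair {1F} {3F} _ = nonadjacent (λ ()) (separates (symm a~b) (a≁d ∘ symm)) b≁d
      pair {2F} {3F} _ = adjacent (Pointwise.inj₂ λ ()) c~d
      pair {1F} {1F} (s≤s ())
      pair {2F} {1F} (s≤s ())
      pair {2F} {2F} (s≤s (s≤s ()))
      pair {3F} {1F} (s≤s ())
      pair {3F} {2F} (s≤s (s≤s ()))
      pair {3F} {3F} (s≤s (s≤s (s≤s ())))

    no-claw : ∀ {x a b c} → Adj G x a → Adj G x b → Adj G x c → a ≢ b → a ≢ c → b ≢ c →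
              ¬ Adj G a b → ¬ Adj G a c → ¬ Adj G b c → ⊥
    no-claw {x} {a} {b} {c} x~a x~b x~c a≢b a≢c b≢c a≁b a≁c b≁c = proj₂ free (copy claw e pair)
      where
      e : Fin 4 → Fin n
      e = Vec.lookup (x ∷ a ∷ b ∷ c ∷ [])
      pair : ∀ {i j} → i Fin.< j → e i ≢ e j × (Adj claw i j ⇔ Adj G (e i) (e j))
      pair {0F} {1F} _ = adjacent (λ ()) x~a
      pair {0F} {2F} _ = adjacent (λ ()) x~b
      pair {0F} {3F} _ = adjacent (λ ()) x~c
      pair {1F} {2F} _ = nonadjacent (λ s≢s → s≢s refl) a≢b a≁b
      pair {1F} {3F} _ = nonadjacent (λ s≢s → s≢s refl) a≢c a≁c
      pair {2F} {3F} _ = nonadjacent (λ s≢s → s≢s refl) b≢c b≁c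
      pair {1F} {1F} (s≤s ())
      pair {2F} {1F} (s≤s ())
      pair {2F} {2F} (s≤s (s≤s ()))
      pair {3F} {1F} (s≤s ())
      pair {3F} {2F} (s≤s (s≤s ()))
      pair {3F} {3F} (s≤s (s≤s (s≤s ())))

  Dominated : Fin n → Fin n → Set
  Dominated u v = u ≢ v × ¬ Adj G u v × (∀ w → Adj G u w → Adj G v w)

  dominated? : Decidable Dominated
  dominated? u v = ¬? (u Fin.≟ v) ×-dec (¬? (adj? G u v) ×-dec
    Fin.all? (λ w → adj? G u w →-dec adj? G v w))

  module _ (free : (2K₂ , claw -Free) G) (undominated : ∀ u v → ¬ Dominated u v) where

    open Structure free
    private
      symm = Graph.sym G

    private-neighbor : ∀ {u v} → u ≢ v → ¬ Adj G u v → ∃[ w ] (Adj G u w × ¬ Adj G v w)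
    private-neighbor {u} {v} u≢v u≁v with Fin.any? (λ w → adj? G u w ×-dec ¬? (adj? G v w))
    ... | yes found = found
    ... | no ¬found = contradiction (u≢v , u≁v , N⊆N) (undominated u v)
      where
      N⊆N : ∀ w → Adj G u w → Adj G v w
      N⊆N w u~w with adj? G v w
      ... | yes v~w = v~w
      ... | no  v≁w = contradiction (w , u~w , v≁w) ¬found

    -- Take for `z` a neighbor of `a` that is not a neighbor of `y`. If `b` were not adjacent to
    -- `z`, then `az` and `by` would induce a `2K₂`.
    common-neighbor : ∀ {a b y} → ¬ Adj G a b → Adj G b y → ¬ Adj G a y →
                      ∃[ z ] (Adj G a z × Adj G b z × ¬ Adj G y z)
    common-neighbor {a} {b} {y} a≁b b~y a≁y
      with private-neighbor (separates (symm b~y) (a≁b) ∘ sym) a≁y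
    ... | z , a~z , y≁z with adj? G b z
    ...   | yes b~z = z , a~z , b~z , y≁z
    ...   | no  b≁z = ⊥-elim (no-2K₂ a~z b~y a≁b a≁y (b≁z ∘ symm) (y≁z ∘ symm))

    no-independent-triple : NoIndependentTriple G
    no-independent-triple a b c a≢b a≢c b≢c a≁b a≁c b≁c =
      let y , b~y , c≁y       = private-neighbor b≢c b≁c
          w , c~w , b~w , _   = common-neighbor (b≁c ∘ symm) b~y c≁y
          a≁w                 = λ a~w → not-all a~w b~w c~w
          z , a~z , b~z , w≁z = common-neighbor a≁b b~w a≁w
          c≁z                 = λ c~z → not-all a~z b~z c~z
      in no-2K₂ a~z c~w a≁c a≁w (c≁z ∘ symm) (w≁z ∘ symm)
      where
      not-all : ∀ {x} → Adj G a x → Adj G b x → ¬ Adj G c x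
      not-all a~x b~x c~x = no-claw (symm a~x) (symm b~x) (symm c~x) a≢b a≢c b≢c a≁b a≁c b≁c

-- Vertex deletion and the retraction onto `G − u`

delete : ∀ {n} → Graph (suc n) → Fin (suc n) → Graph n
delete G u = record
  { Adj    = λ x y → Adj G (Fin.punchIn u x) (Fin.punchIn u y)
  ; adj?   = λ x y → adj? G (Fin.punchIn u x) (Fin.punchIn u y)
  ; sym    = Graph.sym G
  ; irrefl = Graph.irrefl G
  }

delete-copy : ∀ {m n} {H : Graph m} (G : Graph (suc n)) u → InducedCopy H (delete G u) → InducedCopy H G
delete-copy G u c = record
  { embed     = Fin.punchIn u ∘ embed
  ; injective = injective ∘ Fin.punchIn-injective u _ _
  ; adj⇔      = adj⇔
  }
  where open InducedCopy c

module Fold {n} (G : Graph (suc n)) {u v} (dom : Dominated G u v) where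

  private
    u≢v : u ≢ v
    u≢v = proj₁ dom
    N⊆N : ∀ w → Adj G u w → Adj G v w
    N⊆N = proj₂ (proj₂ dom)

  -- The retraction that sends `u` to `v` and fixes all other vertices, in the numbering of
  -- `delete G u`.
  fold : Fin (suc n) → Fin n
  fold w with u Fin.≟ w
  ... | yes _  = Fin.punchOut u≢v
  ... | no u≢w = Fin.punchOut u≢w

  -- Folding one end of an edge at a time serves twice: applied to both ends it makes `fold` a
  -- homomorphism, and applied to one end it gives the edge condition of `recolor-all` in
  -- `to-folded`.
  adj-fold : ∀ {x y} → Adj G x y → Adj G x (Fin.punchIn u (fold y))
  adj-fold {x} {y} x~y with u Fin.≟ y
  ... | yes refl = subst (Adj G x) (sym (Fin.punchIn-punchOut u≢v))
    (Graph.sym G (N⊆N x (Graph.sym G x~y)))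
  ... | no u≢y = subst (Adj G x) (sym (Fin.punchIn-punchOut u≢y)) x~y

  fold-hom : ∀ {x y} → Adj G x y → Adj (delete G u) (fold x) (fold y)
  fold-hom = Graph.sym G ∘ adj-fold ∘ Graph.sym G ∘ adj-fold

  module _ {k : ℕ} where

    restrict : Coloring G k → Coloring (delete G u) k
    restrict = pullback (Fin.punchIn u) id

    extend : Coloring (delete G u) k → Coloring G k
    extend = pullback fold fold-hom

    -- Only `u` changes, taking the color of `v`.
    to-folded : ∀ (α : Coloring G k) → α ⟶[ const 1 ] extend (restrict α)
    to-folded α = recolor-all α _ (proper α ∘ adj-fold) (λ _ _ → ℕ.≤-refl)

-- The bound `n + 2` of `recolor-α≤2` is at most `2 * n` only from two vertices on, so smaller
-- graphs are treated directly.
recolor-triple-free : ∀ {n} (G : Graph n) → NoIndependentTriple G → ∀ {r k} → r < k → Coloring G r →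
                      (α β : Coloring G k) → α ⟶[ const (2 * n) ] β
recolor-triple-free {zero}        G α≤2 r<k γ α β = done λ ()
recolor-triple-free {suc zero}    G α≤2 r<k γ α β = recolor-all α β
  (λ { {0F} {0F} x~x → ⊥-elim (Graph.irrefl G x~x) }) (λ _ _ → s≤s z≤n)
recolor-triple-free {suc (suc m)} G α≤2 r<k γ α β = weaken cost (recolor-α≤2 α≤2 r<k γ α β)
  where
  n = suc (suc m)
  cost : Fin n → 1 + (n + 1) ≤ 2 * n
  cost _ = subst (_≤ 2 * n) (ℕ.+-suc n 1) (ℕ.+-monoʳ-≤ n (s≤s (s≤s z≤n)))

-- Induction on `n`. The hypothesis speaks of some coloring with `r < k` colors instead of the
-- chromatic number, so that `restrict γ` provides it for `G − u`.
recolor-free : ∀ n (G : Graph n) → (2K₂ , claw -Free) G → ∀ {r k} → r < k → Coloring G r →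
               (α β : Coloring G k) → α ⟶[ const (2 * n) ] β
recolor-free zero    G free r<k γ α β = done λ ()
recolor-free (suc n) G free@(¬2K₂ , ¬claw) r<k γ α β
  with Fin.any? (λ u → Fin.any? (dominated? G u))
... | yes (u , v , dom) = weaken cost
  (⟶-trans (to-folded α) (⟶-trans
    (pullback-⟶ fold fold-hom (recolor-free n (delete G u)
      (¬2K₂ ∘ delete-copy G u , ¬claw ∘ delete-copy G u) r<k (restrict γ) (restrict α) (restrict β)))
    (reverse (to-folded β))))
  where
  open Fold G dom
  -- One recoloring folds `α`, `2 * n` come from `G − u`, and one unfolds to `β`.
  cost : ∀ (w : Fin (suc n)) → 1 + (2 * n + 1) ≤ 2 * suc n
  cost _ = ℕ.≤-reflexive (trans (cong suc (ℕ.+-comm (2 * n) 1)) (sym (ℕ.*-suc 2 n)))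
... | no ¬dom = recolor-triple-free G
    (no-independent-triple G free λ u v dom → ¬dom (u , v , dom)) r<k γ α β

-- Existence of the diameter

least : ∀ {P : ℕ → Set} → (∀ m → Dec (P m)) → ∀ m → P m → ∃[ l ] (l ≤ m × IsLeast P l)
least {P} P? = <-rec _ λ m rec Pm → search m rec Pm (ℕ.anyUpTo? P? m)
  where
  search : ∀ m → (∀ {l} → l < m → P l → ∃[ l′ ] (l′ ≤ l × IsLeast P l′)) → P m →
           Dec (∃[ l ] (l < m × P l)) → ∃[ l ] (l ≤ m × IsLeast P l)
  search m rec Pm (yes (l , l<m , Pl)) with rec l<m Pl
  ... | l′ , l′≤l , isLeast = l′ , ℕ.≤-trans l′≤l (ℕ.<⇒≤ l<m) , isLeast
  search m rec Pm (no ¬below) = m , ℕ.≤-refl , Pm , λ l Pl → ℕ.≮⇒≥ λ l<m → ¬below (l , l<m , Pl)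

module Diameter {n} (G : Graph n) (k : ℕ) where

  open Reconfiguration G k using (_≈_; _~_)

  open RecoloringWalk G k

  _≈?_ : Decidable _≈_
  α ≈? β = Fin.all? λ v → color α v Fin.≟ color β v

  _~?_ : Decidable _~_
  α ~? β = Fin.any? λ v → ¬? (color α v Fin.≟ color β v) ×-dec
    map′ (λ u {w} → u w) (λ u w → u) (Fin.all? λ w → ¬? (color α w Fin.≟ color β w) →-dec (v Fin.≟ w))

  module Enumerated (colorings : List (Coloring G k)) (enumerated : ∀ α → Any (α ≈_) colorings) where

    -- The second coloring of a walk can be replaced by a listed one that agrees with it pointwise,
    -- so a finite search over first steps decides.
    walk? : ∀ l → Decidable (RWalk l)
    walk? zero    α β = map′ stop (λ { (stop α≈β) → α≈β }) (α ≈? β)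
    walk? (suc l) α β = map′ join split
      (Any.any? (λ γ → (α ~? γ) ×-dec walk? l γ β) colorings)
      where
      join : Any (λ γ → α ~ γ × RWalk l γ β) colorings → RWalk (suc l) α β
      join found with find found
      ... | γ , _ , α~γ , w = step α~γ w
      split : RWalk (suc l) α β → Any (λ γ → α ~ γ × RWalk l γ β) colorings
      split (step {y = γ} α~γ w) = Any.map
        (λ {γ′} γ≈γ′ → ~-resp {α} {α} {γ} {γ′} (λ _ → refl) γ≈γ′ α~γ ,
          walk-resp {α = γ} {γ′} {β} {β} γ≈γ′ (λ _ → refl) w) (enumerated γ)

    module _ {B : ℕ} (short : ∀ α β → ∃[ l ] (l ≤ B × RWalk l α β)) where

      connected : R-Connected G k
      connected α β with short α β
      ... | l , _ , w = l , w

      private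
        distance : ∀ α β → ∃[ d ] (d ≤ B × IsDistance _≈_ _~_ α β d)
        distance α β with short α β
        ... | l , l≤B , w with least (λ m → walk? m α β) l w
        ...   | d , d≤l , isLeast = d , ℕ.≤-trans d≤l l≤B , isLeast

        dist : Coloring G k × Coloring G k → ℕ
        dist (α , β) = proj₁ (distance α β)

      diameter : Coloring G k → ∃[ D ] (R-IsDiameter G k D × D ≤ B)
      diameter γ = dist far , (connected , (proj₁ far , proj₂ far , distance-least far) , maximal) , distance-≤ far
        where
        distance-≤ : ∀ p → dist p ≤ B
        distance-≤ (α , β) = proj₁ (proj₂ (distance α β))
        distance-least : ∀ p → IsDistance _≈_ _~_ (proj₁ p) (proj₂ p) (dist p)
        distance-least (α , β) = proj₂ (proj₂ (distance α β))
        pairs = cartesianProduct colorings colorings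
        -- `argmax` needs a starting value; `γ` supplies one and shows that there is a distance to
        -- attain.
        far = argmax dist (γ , γ) pairs
        maximal : ∀ d → ∃[ α ] ∃[ β ] IsDistance _≈_ _~_ α β d → d ≤ dist far
        -- Distances are compared through listed colorings `α′` and `β′` that agree pointwise with
        -- `α` and `β`.
        maximal d (α , β , _ , shortest) =
          let α′ , α′∈ , α≈α′ = find (enumerated α)
              β′ , β′∈ , β≈β′ = find (enumerated β)
          in ℕ.≤-trans
            (shortest (dist (α′ , β′)) (walk-resp {dist (α′ , β′)} {α′} {α} {β′} {β}
              (sym ∘ α≈α′) (sym ∘ β≈β′) (proj₁ (distance-least (α′ , β′)))))
            (All.lookup (f[xs]≤f[argmax] {f = dist} (γ , γ) pairs) (∈-cartesianProduct⁺ α′∈ β′∈))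

  -- Enumeration of the colorings among all `k ^ n` maps

  Proper : (Fin n → Fin k) → Set
  Proper f = ∀ x y → Adj G x y → f x ≢ f y

  proper? : ∀ f → Dec (Proper f)
  proper? f = Fin.all? λ x → Fin.all? λ y → adj? G x y →-dec ¬? (f x Fin.≟ f y)

  toColoring : ∀ {f} → Dec (Proper f) → Maybe (Coloring G k)
  toColoring {f} (yes p) = just (record { color = f ; proper = p _ _ })
  toColoring     (no  _) = nothing

  toColoring-≈ : ∀ {f} (p? : Dec (Proper f)) (α : Coloring G k) → color α ≗ f →
                 Maybe.Any (α ≈_) (toColoring p?)
  toColoring-≈ (yes p) α α≗f = Maybe.just α≗f
  toColoring-≈ (no ¬p) α α≗f =
    contradiction (λ x y x~y → subst₂ _≢_ (α≗f x) (α≗f y) (proper α x~y)) ¬p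

  decode : Fin (k ^ n) → Maybe (Coloring G k)
  decode i = toColoring (proper? (Fin.finToFun i))

  colorings : List (Coloring G k)
  colorings = mapMaybe decode (allFin (k ^ n))

  enumerated : ∀ α → Any (α ≈_) colorings
  enumerated α = Any.mapMaybe⁺ decode (allFin (k ^ n)) (Any.map⁺ (lose (∈-allFin code)
    (toColoring-≈ (proper? (Fin.finToFun code)) α (sym ∘ Fin.finToFun-funToFin (color α)))))
    where
    code : Fin (k ^ n)
    code = Fin.funToFin (color α)

  open Enumerated colorings enumerated public

theorem11 : ∀ (n : ℕ) (G : Graph n) → (2K₂ , claw -Free) G →
    Recolorable G ×
    (∀ χ → IsChromaticNumber G χ → ∀ ℓ → ℓ ≥ χ + 1 →
    ∃[ D ] (R-IsDiameter G ℓ D × D ≤ 2 * n ^ 2))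
theorem11 n G free =
  (λ χ (γ , _) ℓ ℓ≥χ+1 → Diameter.connected G ℓ (short γ ℓ≥χ+1)) ,
  (λ χ (γ , _) ℓ ℓ≥χ+1 → Diameter.diameter G ℓ (short γ ℓ≥χ+1) (inflate γ ℓ≥χ+1))
  where
  χ<ℓ : ∀ {χ ℓ} → ℓ ≥ χ + 1 → χ < ℓ
  χ<ℓ {χ} {ℓ} = subst (_≤ ℓ) (ℕ.+-comm χ 1)

  -- The diameter is a maximum over pairs of `ℓ`-colorings, so at least one `ℓ`-coloring has to be
  -- exhibited.
  inflate : ∀ {χ ℓ} → Coloring G χ → ℓ ≥ χ + 1 → Coloring G ℓ
  inflate {χ} {ℓ} γ ℓ≥χ+1 = record
    { color  = λ v → Fin.inject≤ (color γ v) χ≤ℓ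
    ; proper = λ x~y → proper γ x~y ∘ Fin.inject≤-injective χ≤ℓ χ≤ℓ _ _ }
    where
    χ≤ℓ : χ ≤ ℓ
    χ≤ℓ = ℕ.<⇒≤ (χ<ℓ ℓ≥χ+1)

  total : sum {n} (const (2 * n)) ≡ 2 * n ^ 2
  total = trans (sum-const n (2 * n)) (trans (sym (ℕ.*-assoc n 2 n)) (trans (cong (_* n) (ℕ.*-comm n 2))
    (trans (ℕ.*-assoc 2 n n) (cong (λ m → 2 * (n * m)) (sym (ℕ.*-identityʳ n))))))

  short : ∀ {χ} {ℓ} → Coloring G χ → ℓ ≥ χ + 1 → ∀ α β → ∃[ l ] (l ≤ 2 * n ^ 2 × RecoloringWalk.RWalk G ℓ l α β)
  short γ ℓ≥χ+1 α β with toWalk (recolor-free n G free (χ<ℓ ℓ≥χ+1) γ α β)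
  ... | l , l≤ , w = l , subst (l ≤_) total l≤ , w
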